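{- Let $D$ be a good digraph (an oriented graph) with no sink. Suppose that for every vertex $x$ incident to a missing edge, the set $J(x)$ contains at least two vertices $p$ with $|N^+_{D[J(x)]}(p)|\le |N^{++}_{D[J(x)]}(p)|$. Then $D$ has at least two vertices $v$ with $|N^+_D(v)|\le|N^{++}_D(v)|$.
   Context: All digraphs are finite oriented graphs. A sink is a vertex of out-degree 0. $N^+(v)$ is the out-neighborhood; $N^{++}(v)$ is the set of vertices $w\notin N^+(v)\cup\{v\}$ with $u\to w$ for some $u\in N^+(v)$; subscripts indicate the digraph. A missing edge is a pair of distinct non-adjacent vertices; a vertex is whole if it lies on no missing edge. For missing edges $\{x,y\},\{a,b\}$, $\{x,y\}$ loses to $\{a,b\}$ if the endpoints can be labelled so that $x\to a$, $b\notin N^+(x)\cup N^{++}(x)$, $y\to b$, $a\notin N^+(y)\cup N^{++}(y)$. The dependency digraph $\Delta$ has the missing edges as vertices and an arc $(e,e')$ whenever $e$ loses to $e'$. For a connected component $C$ of $\Delta$, $K(C)$ is the set of vertices of $D$ lying on missing edges of $C$. The interval graph $\mathcal I_D$ has the connected components of $\Delta$ as vertices, two being adjacent if their $K$-sets intersect; for a connected component $\xi$ of $\mathcal I_D$, $K(\xi)=\bigcup_{C\in\xi}K(C)$. $J(f)=\{f\}$ if $f$ is whole, and otherwise $J(f)=K(\xi)$ for the unique $\xi$ with $f\in K(\xi)$. A set $K$ is an interval of $D$ if $N^+(u)\setminus K=N^+(v)\setminus K$ and $N^-(u)\setminus K=N^-(v)\setminus K$ for all $u,v\in K$. $D$ is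 good if every $K(\xi)$ is an interval of $D$. -}

module Defs where

open import Level using (0ℓ)
open import Data.Empty using (⊥-elim-irr)
open import Data.Nat.Base using (ℕ; _≤_)
open import Data.Fin.Base using (Fin; _<_)
open import Data.Fin.Properties using (_≟_; _<?_; any?)
open import Data.Fin.Subset
  using (Subset; _∈_; _∉_; _∪_; _∩_; _─_; ⁅_⁆; ∣_∣; Nonempty)
open import Data.Fin.Subset.Properties using (_∈?_; nonempty?; x∈p∩q⁺)
open import Data.List.Base using (List; []; _∷_; mapMaybe; allFin; cartesianProduct)
open import Data.List.Membership.Propositional renaming (_∈_ to _∈ˡ_) using ()
open import Data.List.Membership.Propositional.Properties
  using (∈-allFin; ∈-cartesianProduct⁺)
open import Data.List.Relation.Unary.Any using (here; there)
open import Data.Maybe.Base using (Maybe; just; nothing)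
open import Data.Product.Base using (_×_; _,_; ∃; ∃-syntax)
open import Data.Sum.Base using (_⊎_; inj₁; inj₂)
open import Data.Vec.Base using (tabulate)
open import Data.Vec.Properties
  using (lookup⇒[]=; []=⇒lookup; lookup∘tabulate)
open import Function.Base using (_∘_)
open import Relation.Binary.Core using (Rel)
open import Relation.Binary.Definitions using (Decidable; Irreflexive; Asymmetric; DecidableEquality)
open import Relation.Binary.Construct.Closure.Equivalence
  using (EqClosure; symmetric)
open import Relation.Binary.Construct.Closure.ReflexiveTransitive using (Star; ε; _◅_; _◅◅_)
open import Relation.Binary.Construct.Closure.Symmetric using (SymClosure; fwd; bwd)
open import Relation.Binary.PropositionalEquality
  using (_≡_; _≢_; refl; sym; trans)
open import Relation.Nullary.Decidable
  using (Dec; yes; no; does; dec-true; map′; _×-dec_; _⊎-dec_; ¬?)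
open import Relation.Nullary.Negation using (¬_)
open import Relation.Unary using (Pred) renaming (Decidable to Decidable₁)

------------------------------------------------------------------------
-- Reachability is decidable over a listable type (Warshall's algorithm)

module Reachability {A : Set} (R : Rel A 0ℓ) where

  -- Paths all of whose intermediate vertices belong to the given list.
  Via : List A → Rel A 0ℓ
  Via []       x y = x ≡ y ⊎ R x y
  Via (k ∷ ks) x y = Via ks x y ⊎ (Via ks x k × Via ks k y)

  via? : DecidableEquality A → Decidable R → ∀ ks → Decidable (Via ks)
  via? _≟ᴬ_ R? []       x y = (x ≟ᴬ y) ⊎-dec R? x y
  via? _≟ᴬ_ R? (k ∷ ks) x y =
    via? _≟ᴬ_ R? ks x y ⊎-dec (via? _≟ᴬ_ R? ks x k ×-dec via? _≟ᴬ_ R? ks k y)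

  via⇒star : ∀ ks {x y} → Via ks x y → Star R x y
  via⇒star []       (inj₁ refl)    = ε
  via⇒star []       (inj₂ r)       = r ◅ ε
  via⇒star (k ∷ ks) (inj₁ p)       = via⇒star ks p
  via⇒star (k ∷ ks) (inj₂ (p , q)) = via⇒star ks p ◅◅ via⇒star ks q

  via-refl : ∀ ks {x} → Via ks x x
  via-refl []       = inj₁ refl
  via-refl (k ∷ ks) = inj₁ (via-refl ks)

  via-step : ∀ ks {x y} → R x y → Via ks x y
  via-step []       r = inj₂ r
  via-step (k ∷ ks) r = inj₁ (via-step ks r)

  via-trans : ∀ ks {x y z} → y ∈ˡ ks → Via ks x y → Via ks y z → Via ks x z
  via-trans (k ∷ ks) (here refl) p q = inj₂ (toHead p , fromHead q)
    where
    toHead : ∀ {x} → Via (k ∷ ks) x k → Via ks x k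
    toHead (inj₁ p)       = p
    toHead (inj₂ (p , _)) = p
    fromHead : ∀ {z} → Via (k ∷ ks) k z → Via ks k z
    fromHead (inj₁ q)       = q
    fromHead (inj₂ (_ , q)) = q
  via-trans (k ∷ ks) (there m) (inj₁ p)        (inj₁ q)        = inj₁ (via-trans ks m p q)
  via-trans (k ∷ ks) (there m) (inj₁ p)        (inj₂ (q , q′)) = inj₂ (via-trans ks m p q , q′)
  via-trans (k ∷ ks) (there m) (inj₂ (p , p′)) (inj₁ q)        = inj₂ (p , via-trans ks m p′ q)
  via-trans (k ∷ ks) (there m) (inj₂ (p , _))  (inj₂ (_ , q′)) = inj₂ (p , q′)

  star⇒via : ∀ ks → (∀ x → x ∈ˡ ks) → ∀ {x y} → Star R x y → Via ks x y
  star⇒via ks all ε       = via-refl ks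
  star⇒via ks all (r ◅ p) = via-trans ks (all _) (via-step ks r) (star⇒via ks all p)

  star? : (ks : List A) → (∀ x → x ∈ˡ ks) →
          DecidableEquality A → Decidable R → Decidable (Star R)
  star? ks all _≟ᴬ_ R? x y =
    map′ (via⇒star ks) (star⇒via ks all) (via? _≟ᴬ_ R? ks x y)

mapMaybe-complete : {A B : Set} (f : A → Maybe B) {x : A} {y : B} {xs : List A} →
                    x ∈ˡ xs → f x ≡ just y → y ∈ˡ mapMaybe f xs
mapMaybe-complete f (here refl) eq rewrite eq = here refl
mapMaybe-complete f {xs = z ∷ _} (there m) eq with f z
... | just _  = there (mapMaybe-complete f m eq)
... | nothing = mapMaybe-complete f m eq

------------------------------------------------------------------------

record OrientedGraph (n : ℕ) : Set₁ where
  infix 4 _⟶_ _⟶?_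
  field
    _⟶_    : Rel (Fin n) 0ℓ
    _⟶?_   : Decidable _⟶_
    irrefl : Irreflexive _≡_ _⟶_
    asym   : Asymmetric _⟶_

comprehension : ∀ {n} {P : Pred (Fin n) 0ℓ} → Decidable₁ P → Subset n
comprehension P? = tabulate (does ∘ P?)

∈-comprehension⁺ : ∀ {n} {P : Pred (Fin n) 0ℓ} (P? : Decidable₁ P) {v} →
                   P v → v ∈ comprehension P?
∈-comprehension⁺ P? {v} p = lookup⇒[]= v (comprehension P?)
  (trans (lookup∘tabulate (does ∘ P?) v) (dec-true (P? v) p))

∈-comprehension⁻ : ∀ {n} {P : Pred (Fin n) 0ℓ} (P? : Decidable₁ P) {v} →
                   v ∈ comprehension P? → P v
∈-comprehension⁻ P? {v} m
  with P? v | trans (sym (lookup∘tabulate (does ∘ P?) v)) ([]=⇒lookup m)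
... | yes p | _ = p

module Neighbourhoods {n : ℕ} (D : OrientedGraph n) where
  open OrientedGraph D

  N⁺ : Fin n → Subset n
  N⁺ v = comprehension (λ w → v ⟶? w)

  N⁻ : Fin n → Subset n
  N⁻ v = comprehension (λ u → u ⟶? v)

  N⁺⁺ : Fin n → Subset n
  N⁺⁺ v = comprehension λ w →
    ¬? (w ∈? (N⁺ v ∪ ⁅ v ⁆)) ×-dec any? (λ u → (u ∈? N⁺ v) ×-dec (u ⟶? w))

  Sink : Fin n → Set
  Sink v = ∣ N⁺ v ∣ ≡ 0

  SecondNeighbourhoodProperty : Fin n → Set
  SecondNeighbourhoodProperty v = ∣ N⁺ v ∣ ≤ ∣ N⁺⁺ v ∣

  IsInterval : Subset n → Set
  IsInterval K = ∀ u v → u ∈ K → v ∈ K →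
    (N⁺ u ─ K ≡ N⁺ v ─ K) × (N⁻ u ─ K ≡ N⁻ v ─ K)

-- The induced subdigraph D[K].  It keeps the ambient vertex type Fin n, the
-- vertices outside K becoming isolated; for a vertex p of K, both N⁺ p and
-- N⁺⁺ p are then the neighbourhoods in the digraph with vertex set K.
-- Quantification over the vertices of D[K] must be restricted to K.
_[_] : ∀ {n} → OrientedGraph n → Subset n → OrientedGraph n
D [ K ] = record
  { _⟶_    = λ u v → u ∈ K × v ∈ K × u ⟶ v
  ; _⟶?_   = λ u v → (u ∈? K) ×-dec (v ∈? K) ×-dec (u ⟶? v)
  ; irrefl = λ { eq (_ , _ , a) → irrefl eq a }
  ; asym   = λ { (_ , _ , a) (_ , _ , b) → asym a b }
  }
  where open OrientedGraph D

module Dependency {n : ℕ} (D : OrientedGraph n) where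
  open OrientedGraph D
  open Neighbourhoods D

  Adjacent : Rel (Fin n) 0ℓ
  Adjacent u v = u ⟶ v ⊎ v ⟶ u

  adjacent? : Decidable Adjacent
  adjacent? u v = (u ⟶? v) ⊎-dec (v ⟶? u)

  -- An unordered pair of distinct non-adjacent vertices, stored with its
  -- smaller endpoint first so that each pair is counted once.
  record MissingEdge : Set where
    constructor missing
    field
      lo hi       : Fin n
      .lo<hi      : lo < hi
      .nonadjacent : ¬ Adjacent lo hi
  open MissingEdge

  infix 4 _IsLabelledBy_ _IsLabelledBy?_ _∈ᵉ_ _∈ᵉ?_ _LosesTo_ _LosesTo?_

  -- e IsLabelledBy (x , y) : {x , y} is e, the endpoints taken in this order.
  _IsLabelledBy_ : MissingEdge → Fin n × Fin n → Set
  e IsLabelledBy (x , y) = (lo e ≡ x × hi e ≡ y) ⊎ (lo e ≡ y × hi e ≡ x)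

  _∈ᵉ_ : Fin n → MissingEdge → Set
  v ∈ᵉ e = v ≡ lo e ⊎ v ≡ hi e

  Whole : Fin n → Set
  Whole v = ∀ e → ¬ (v ∈ᵉ e)

  -- The arcs of the dependency digraph.
  _LosesTo_ : Rel MissingEdge 0ℓ
  e LosesTo e′ = ∃[ x ] ∃[ y ] ∃[ a ] ∃[ b ]
    e IsLabelledBy (x , y) × e′ IsLabelledBy (a , b) ×
    x ⟶ a × b ∉ N⁺ x ∪ N⁺⁺ x ×
    y ⟶ b × a ∉ N⁺ y ∪ N⁺⁺ y

  -- A connected component of the dependency digraph is represented by any one
  -- of its members: C and C′ represent the same component when C ≈Δ C′.
  infix 4 _≈Δ_ _≈Δ?_ _≈𝓘_ _≈𝓘?_

  _≈Δ_ : Rel MissingEdge 0ℓ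
  _≈Δ_ = EqClosure _LosesTo_

  missingEdge? : (p : Fin n × Fin n) → Maybe MissingEdge
  missingEdge? (x , y) with x <? y | adjacent? x y
  ... | yes x<y | no ¬a = just (missing x y x<y ¬a)
  ... | _       | _     = nothing

  missingEdges : List MissingEdge
  missingEdges = mapMaybe missingEdge? (cartesianProduct (allFin n) (allFin n))

  missingEdges-complete : ∀ e → e ∈ˡ missingEdges
  missingEdges-complete e =
    mapMaybe-complete missingEdge?
      (∈-cartesianProduct⁺ (∈-allFin (lo e)) (∈-allFin (hi e))) (found e)
    where
    found : ∀ e → missingEdge? (lo e , hi e) ≡ just e
    found (missing x y x<y ¬a) with x <? y | adjacent? x y
    ... | yes _  | no _  = refl
    ... | yes _  | yes a = ⊥-elim-irr (¬a a)
    ... | no x≮y | _     = ⊥-elim-irr (x≮y x<y)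

  _≟ᵉ_ : DecidableEquality MissingEdge
  missing x y _ _ ≟ᵉ missing x′ y′ _ _ =
    map′ (λ { (refl , refl) → refl }) (λ { refl → refl , refl })
         ((x ≟ x′) ×-dec (y ≟ y′))

  anyMissing? : {P : Pred MissingEdge 0ℓ} → Decidable₁ P → Dec (∃ P)
  anyMissing? P? = map′ satisfied (λ { (e , p) → lose (missingEdges-complete e) p })
                        (anyList? P? missingEdges)
    where
    open import Data.List.Relation.Unary.Any using (satisfied) renaming (any? to anyList?)
    open import Data.List.Membership.Propositional using (lose)

  _IsLabelledBy?_ : ∀ e p → Dec (e IsLabelledBy p)
  e IsLabelledBy? (x , y) =
    ((lo e ≟ x) ×-dec (hi e ≟ y)) ⊎-dec ((lo e ≟ y) ×-dec (hi e ≟ x))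

  _∈ᵉ?_ : ∀ v e → Dec (v ∈ᵉ e)
  v ∈ᵉ? e = (v ≟ lo e) ⊎-dec (v ≟ hi e)

  whole? : Decidable₁ Whole
  whole? v = map′ (λ ¬∃ e i → ¬∃ (e , i)) (λ { w (e , i) → w e i })
                  (¬? (anyMissing? (v ∈ᵉ?_)))

  _LosesTo?_ : Decidable _LosesTo_
  e LosesTo? e′ = any? λ x → any? λ y → any? λ a → any? λ b →
    (e IsLabelledBy? (x , y)) ×-dec (e′ IsLabelledBy? (a , b)) ×-dec
    (x ⟶? a) ×-dec ¬? (b ∈? N⁺ x ∪ N⁺⁺ x) ×-dec
    (y ⟶? b) ×-dec ¬? (a ∈? N⁺ y ∪ N⁺⁺ y)

  eqClosure? : {R : Rel MissingEdge 0ℓ} → Decidable R → Decidable (EqClosure R)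
  eqClosure? {R} R? = Reachability.star? (SymClosure R) missingEdges
    missingEdges-complete _≟ᵉ_ λ e e′ →
      map′ (λ { (inj₁ r) → fwd r ; (inj₂ r) → bwd r })
           (λ { (fwd r) → inj₁ r ; (bwd r) → inj₂ r })
           (R? e e′ ⊎-dec R? e′ e)

  _≈Δ?_ : Decidable _≈Δ_
  _≈Δ?_ = eqClosure? _LosesTo?_

  -- K(C)
  LiesOn : MissingEdge → Pred (Fin n) 0ℓ
  LiesOn C v = ∃[ e ] C ≈Δ e × v ∈ᵉ e

  liesOn? : ∀ C → Decidable₁ (LiesOn C)
  liesOn? C v = anyMissing? λ e → (C ≈Δ? e) ×-dec (v ∈ᵉ? e)

  K : MissingEdge → Subset n
  K C = comprehension (liesOn? C)

  -- Adjacency in the interval graph, on representatives of its vertices.  It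
  -- also relates C to itself, and so identifies different representatives of
  -- one component; neither affects connectedness.
  Meets : Rel MissingEdge 0ℓ
  Meets C C′ = Nonempty (K C ∩ K C′)

  -- A connected component ξ of the interval graph is likewise represented by
  -- any C in it (hence by any missing edge of any such C).
  _≈𝓘_ : Rel MissingEdge 0ℓ
  _≈𝓘_ = EqClosure Meets

  _≈𝓘?_ : Decidable _≈𝓘_
  _≈𝓘?_ = eqClosure? (λ C C′ → nonempty? (K C ∩ K C′))

  -- K(ξ)
  LiesOn𝓘 : MissingEdge → Pred (Fin n) 0ℓ
  LiesOn𝓘 ξ v = ∃[ C ] ξ ≈𝓘 C × v ∈ K C

  liesOn𝓘? : ∀ ξ → Decidable₁ (LiesOn𝓘 ξ)
  liesOn𝓘? ξ v = anyMissing? λ C → (ξ ≈𝓘? C) ×-dec (v ∈? K C)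

  K𝓘 : MissingEdge → Subset n
  K𝓘 ξ = comprehension (liesOn𝓘? ξ)

  K𝓘-unique : ∀ {f ξ ξ′} → f ∈ K𝓘 ξ → f ∈ K𝓘 ξ′ → ξ ≈𝓘 ξ′
  K𝓘-unique {f} {ξ} {ξ′} m m′ =
    let C  , p  , i  = ∈-comprehension⁻ (liesOn𝓘? ξ) m
        C′ , p′ , i′ = ∈-comprehension⁻ (liesOn𝓘? ξ′) m′
    in p ◅◅ fwd (f , x∈p∩q⁺ (i , i′)) ◅ symmetric Meets p′

  -- For f not whole, this is written as the union of the sets K(ξ) containing
  -- f; by K𝓘-unique there is only one such ξ.
  J : Fin n → Subset n
  J f with whole? f
  ... | yes _ = ⁅ f ⁆
  ... | no  _ = comprehension λ v →
                  anyMissing? λ ξ → (f ∈? K𝓘 ξ) ×-dec (v ∈? K𝓘 ξ)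

  Good : Set
  Good = ∀ ξ → IsInterval (K𝓘 ξ)

AtLeastTwo : ∀ {n} → Pred (Fin n) 0ℓ → Set
AtLeastTwo P = ∃[ p ] ∃[ q ] p ≢ q × P p × P q

-- Since D is good, contracting the sets J(x) to single vertices of weight |J(x)|
-- turns D into a weighted tournament.  Order its vertices so that the total
-- weight of forward arcs is maximal.  As for unweighted tournaments (Havet and
-- Thomassé), the last vertex f, called the feed, has a second out-neighbourhood
-- of at least the weight of its out-neighbourhood.  A vertex of J(f) with the
-- property inside D[J(f)] then has it in D, which settles the case where f is
-- not whole.
--
-- If f is whole, it has the property itself, and a second vertex is found at
-- the feed y of an order with f removed.  As y → f, the inequality between the
-- two neighbourhoods of y has to be strict there.  In case of equality one
-- sediments: moving the in-neighbours of y that are not second out-neighbours of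
-- y (the bad vertices) to the front, followed by y and then the remaining
-- vertices, preserves maximality.  Second out-neighbours are taken with f
-- present, so an out-neighbour of f is never bad; each sedimentation brings it
-- nearer to the end of the order, and hence the process stops.

module Submission where

open import Defs
open import Level using (0ℓ)
open import Data.Bool.Base using (true; false; if_then_else_)
open import Data.Empty using (⊥)
open import Data.Nat.Base using (ℕ; zero; suc; _+_; _*_; _≤_; _<_; z≤n; s≤s; NonZero; >-nonZero)
open import Data.Nat.Properties hiding (_≟_; <-cmp)
open import Data.Nat.ListAction using (sum)
open import Data.Nat.ListAction.Properties using (sum-++; sum-↭)
open import Data.Nat.Tactic.RingSolver using (solve-∀)
open import Data.Fin.Base using (Fin; zero; suc)
open import Data.Fin.Properties using (any?; _≟_; <-cmp)
open import Data.Fin.Subset using (Subset; _∈_; _∉_; _∪_; _─_; ⁅_⁆; ∣_∣) renaming (⊥ to ∅)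
open import Data.Fin.Subset.Properties
  using (_∈?_; x∈⁅x⁆; x∈⁅y⁆⇒x≡y; ∣⁅x⁆∣≡1; ∣⊥∣≡0; p⊆q⇒∣p∣≤∣q∣; p─q⊆p; x∈p∧x∉q⇒x∈p─q; x∈p∪q⁻; x∈p∪q⁺)
open import Data.List.Base as List
  using (List; []; _∷_; _++_; _∷ʳ_; map; filter; length; allFin; deduplicate; initLast; _∷ʳ′_)
open import Data.List.Properties
  using (map-++; map-tabulate; ++-assoc; ++-identityʳ; filter-++; filter-accept; length-filter; length-++)
open import Data.List.Membership.Propositional using (find) renaming (_∈_ to _∈ˡ_)
open import Data.List.Membership.Propositional.Properties using (∈-∃++; ∈-allFin; ∈-++⁻)
open import Data.List.Relation.Unary.All as All using (All; []; _∷_)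
open import Data.List.Relation.Unary.All.Properties using (∷ʳ⁺; ++⁻ʳ)
open import Data.List.Relation.Unary.AllPairs using (AllPairs; []; _∷_)
open import Data.List.Relation.Unary.Any as Any using (Any; here; there)
open import Data.List.Relation.Unary.Any.Properties using (deduplicate⁺)
open import Data.List.Relation.Unary.Unique.DecSetoid.Properties using (deduplicate-!)
open import Data.List.Relation.Binary.Permutation.Propositional
  using (_↭_; ↭-refl; ↭-sym; ↭-trans; prep; ↭⇒↭ₛ; module PermutationReasoning)
open import Data.List.Relation.Binary.Permutation.Propositional.Properties
  using (map⁺; shift; shifts; ++⁺ˡ; ++⁺ʳ; All-resp-↭; Any-resp-↭; ∈-resp-↭; ∷↭∷ʳ)
import Data.List.Relation.Binary.Permutation.Setoid.Properties as ↭ₛ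
open import Data.Product.Base using (_×_; _,_; proj₁; proj₂; ∃-syntax)
open import Data.Sum.Base using (_⊎_; inj₁; inj₂)
open import Data.Vec.Base using ([]; _∷_)
open import Function.Base using (_∘_)
open import Relation.Binary.Bundles using (DecSetoid)
open import Relation.Binary.Core using (Rel)
open import Relation.Binary.Definitions using (Decidable; Asymmetric; tri<; tri≈; tri>)
open import Relation.Binary.Construct.Closure.ReflexiveTransitive using (ε; _◅◅_)
open import Relation.Binary.PropositionalEquality
  using (_≡_; refl; sym; trans; cong; cong₂; subst; subst₂; setoid; resp₂; module ≡-Reasoning)
open import Relation.Nullary.Decidable using (Dec; yes; no; does; _×-dec_; ¬?; decidable-stable)
open import Relation.Nullary.Negation using (¬_; contradiction)
open import Relation.Unary using (Pred) renaming (Decidable to Decidable₁)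

-- Indicators and finite sums

ι : {P : Set} → Dec P → ℕ
ι P? = if does P? then 1 else 0

ι-yes : {P : Set} (P? : Dec P) → P → ι P? ≡ 1
ι-yes (yes _) _ = refl
ι-yes (no ¬p) p = contradiction p ¬p

ι-no : {P : Set} (P? : Dec P) → ¬ P → ι P? ≡ 0
ι-no (yes p) ¬p = contradiction p ¬p
ι-no (no _)  _  = refl

ι-mono : {P Q : Set} (P? : Dec P) (Q? : Dec Q) → (P → Q) → ι P? ≤ ι Q?
ι-mono (yes p) Q? P⇒Q = ≤-reflexive (sym (ι-yes Q? (P⇒Q p)))
ι-mono (no _)  _  _   = z≤n

ι-cong : {P Q : Set} (P? : Dec P) (Q? : Dec Q) → (P → Q) → (Q → P) → ι P? ≡ ι Q?
ι-cong P? Q? P⇒Q Q⇒P = ≤-antisym (ι-mono P? Q? P⇒Q) (ι-mono Q? P? Q⇒P)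

ι-cover : {P Q R : Set} (P? : Dec P) (Q? : Dec Q) (R? : Dec R) →
          (P → Q ⊎ R) → ι P? ≤ ι Q? + ι R?
ι-cover (no _)  Q? R? _     = z≤n
ι-cover (yes p) Q? R? cover with cover p
... | inj₁ q = ≤-trans (≤-reflexive (sym (ι-yes Q? q))) (m≤m+n (ι Q?) (ι R?))
... | inj₂ r = ≤-trans (≤-reflexive (sym (ι-yes R? r))) (m≤n+m (ι R?) (ι Q?))

ι-disjoint : {P Q R : Set} (P? : Dec P) (Q? : Dec Q) (R? : Dec R) →
             (Q → P) → (R → P) → (Q → ¬ R) → ι Q? + ι R? ≤ ι P?
ι-disjoint P? (no _)  R?      _   R⇒P _  = ι-mono R? P? R⇒P
ι-disjoint P? (yes q) (no _)  Q⇒P _   _  = ≤-reflexive (sym (ι-yes P? (Q⇒P q)))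
ι-disjoint P? (yes q) (yes r) _   _   ¬both = contradiction r (¬both q)

module _ {A : Set} where

  ∑ : List A → (A → ℕ) → ℕ
  ∑ xs h = sum (map h xs)

  ∑-++ : ∀ h xs ys → ∑ (xs ++ ys) h ≡ ∑ xs h + ∑ ys h
  ∑-++ h xs ys = trans (cong sum (map-++ h xs ys)) (sum-++ (map h xs) (map h ys))

  ∑-↭ : ∀ h {xs ys} → xs ↭ ys → ∑ xs h ≡ ∑ ys h
  ∑-↭ h p = sum-↭ (map⁺ h p)

  ∑-mono-All : ∀ {h k} {xs} → All (λ x → h x ≤ k x) xs → ∑ xs h ≤ ∑ xs k
  ∑-mono-All []       = z≤n
  ∑-mono-All (p ∷ ps) = +-mono-≤ p (∑-mono-All ps)

  ∑-mono : ∀ {h k} → (∀ x → h x ≤ k x) → ∀ xs → ∑ xs h ≤ ∑ xs k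
  ∑-mono h≤k xs = ∑-mono-All (All.universal h≤k xs)

  ∑-cong : ∀ {h k} → (∀ x → h x ≡ k x) → ∀ xs → ∑ xs h ≡ ∑ xs k
  ∑-cong h≡k []       = refl
  ∑-cong h≡k (x ∷ xs) = cong₂ _+_ (h≡k x) (∑-cong h≡k xs)

  ∑-zero : ∀ xs → ∑ xs (λ _ → 0) ≡ 0
  ∑-zero []       = refl
  ∑-zero (x ∷ xs) = ∑-zero xs

  ∑-+ : ∀ h k xs → ∑ xs (λ x → h x + k x) ≡ ∑ xs h + ∑ xs k
  ∑-+ h k []       = refl
  ∑-+ h k (x ∷ xs) rewrite ∑-+ h k xs = interchange (h x) (k x) (∑ xs h) (∑ xs k)
    where
    interchange : ∀ a b c d → a + b + (c + d) ≡ a + c + (b + d)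
    interchange = solve-∀

  ∑-*ʳ : ∀ h c xs → ∑ xs (λ x → h x * c) ≡ ∑ xs h * c
  ∑-*ʳ h c []       = refl
  ∑-*ʳ h c (x ∷ xs) rewrite ∑-*ʳ h c xs = sym (*-distribʳ-+ c (h x) (∑ xs h))

∑-swap : {A B : Set} (h : A → B → ℕ) (xs : List A) (ys : List B) →
         ∑ xs (λ x → ∑ ys (h x)) ≡ ∑ ys (λ y → ∑ xs (λ x → h x y))
∑-swap h []       ys = sym (∑-zero ys)
∑-swap h (x ∷ xs) ys rewrite ∑-swap h xs ys =
  sym (∑-+ (h x) (λ y → ∑ xs (λ x → h x y)) ys)

∣∣≡∑ : ∀ {n} (S : Subset n) → ∣ S ∣ ≡ ∑ (allFin n) (λ v → ι (v ∈? S))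
∣∣≡∑ S = trans (count S) (cong sum (sym (map-tabulate (λ v → v) (λ v → ι (v ∈? S)))))
  where
  count : ∀ {n} (S : Subset n) → ∣ S ∣ ≡ sum (List.tabulate (λ v → ι (v ∈? S)))
  count []          = refl
  count (true  ∷ S) = cong suc (count S)
  count (false ∷ S) = count S

-- Some entry of `L` is equivalent to `v`, and two of them would be equivalent to each other through
-- `v`.
∑-representatives : {A : Set} {_~_ : Rel A 0ℓ} (_~?_ : Decidable _~_) →
  (∀ {x y} → x ~ y → y ~ x) → (∀ {x y z} → x ~ y → y ~ z → x ~ z) →
  ∀ {v L} → AllPairs (λ x y → ¬ x ~ y) L → Any (v ~_) L → ∑ L (λ r → ι (r ~? v)) ≡ 1
∑-representatives {A} {_~_} _~?_ ~-sym ~-trans = go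
  where
  none : ∀ {v L} → All (λ r → ¬ r ~ v) L → ∑ L (λ r → ι (r ~? v)) ≡ 0
  none []               = refl
  none (_∷_ {r} ¬r~v ps) = cong₂ _+_ (ι-no (r ~? _) ¬r~v) (none ps)
  go : ∀ {v L} → AllPairs (λ x y → ¬ x ~ y) L → Any (v ~_) L → ∑ L (λ r → ι (r ~? v)) ≡ 1
  go {v} {r ∷ _} (≁r ∷ _) (here v~r) = cong₂ _+_ (ι-yes (r ~? v) (~-sym v~r))
    (none (All.map (λ r≁s s~v → r≁s (~-sym (~-trans s~v v~r))) ≁r))
  go {v} {r ∷ _} (≁r ∷ ps) (there i) = cong₂ _+_ (ι-no (r ~? v) (r≁v ≁r i)) (go ps i)
    where
    r≁v : ∀ {L} → All (λ s → ¬ r ~ s) L → Any (v ~_) L → ¬ r ~ v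
    r≁v (r≁s ∷ _) (here v~s) r~v = r≁s (~-trans r~v v~s)
    r≁v (_ ∷ ps)  (there i)      = r≁v ps i

-- Weighted tournaments and their median orders

module WeightedTournament
  {n : ℕ} (_⟶_ : Rel (Fin n) 0ℓ) (_⟶?_ : Decidable _⟶_) (asym : Asymmetric _⟶_)
  (_~_ : Rel (Fin n) 0ℓ) (respʳ : ∀ {x y z} → x ~ y → z ⟶ x → z ⟶ y)
  (trichotomy : ∀ x y → x ~ y ⊎ x ⟶ y ⊎ y ⟶ x)
  (ω : Fin n → ℕ) (ω>0 : ∀ x → 0 < ω x)
  where

  irreflexive : ∀ {x} → ¬ x ⟶ x
  irreflexive x⟶x = asym x⟶x x⟶x

  -- The condition v ⟶ x expresses that v is neither equivalent to x nor an
  -- out-neighbour of x.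
  _⇉_ : Rel (Fin n) 0ℓ
  x ⇉ v = v ⟶ x × ∃[ u ] x ⟶ u × u ⟶ v

  _⇉?_ : Decidable _⇉_
  x ⇉? v = (v ⟶? x) ×-dec any? λ u → (x ⟶? u) ×-dec (u ⟶? v)

  out into second : Fin n → List (Fin n) → ℕ
  out    x V = ∑ V λ v → ω v * ι (x ⟶? v)
  into   x V = ∑ V λ v → ω v * ι (v ⟶? x)
  second x V = ∑ V λ v → ω v * ι (x ⇉? v)

  ω*ι≤ω : {P : Set} → ∀ v (P? : Dec P) → ω v * ι P? ≤ ω v
  ω*ι≤ω v (yes _) = ≤-reflexive (*-identityʳ (ω v))
  ω*ι≤ω v (no  _) = ≤-trans (≤-reflexive (*-zeroʳ (ω v))) z≤n

  out-++ : ∀ x V V′ → out x (V ++ V′) ≡ out x V + out x V′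
  out-++ x = ∑-++ λ v → ω v * ι (x ⟶? v)

  second-++ : ∀ x V V′ → second x (V ++ V′) ≡ second x V + second x V′
  second-++ x = ∑-++ λ v → ω v * ι (x ⇉? v)

  out-↭ : ∀ x {V V′} → V ↭ V′ → out x V ≡ out x V′
  out-↭ x = ∑-↭ λ v → ω v * ι (x ⟶? v)

  into-↭ : ∀ x {V V′} → V ↭ V′ → into x V ≡ into x V′
  into-↭ x = ∑-↭ λ v → ω v * ι (v ⟶? x)

  second-↭ : ∀ x {V V′} → V ↭ V′ → second x V ≡ second x V′
  second-↭ x = ∑-↭ λ v → ω v * ι (x ⇉? v)

  out-∷ʳ-self : ∀ x V → out x (V ∷ʳ x) ≡ out x V
  out-∷ʳ-self x V = begin
    out x (V ∷ʳ x)                     ≡⟨ out-↭ x (∷↭∷ʳ x V) ⟨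
    ω x * ι (x ⟶? x) + out x V         ≡⟨ cong (λ i → ω x * i + out x V) (ι-no (x ⟶? x) irreflexive) ⟩
    ω x * 0 + out x V                  ≡⟨ cong (_+ out x V) (*-zeroʳ (ω x)) ⟩
    out x V                            ∎
    where open ≡-Reasoning

  out-∷ʳ-≤ : ∀ x V v → out x (V ∷ʳ v) ≤ ω v + out x V
  out-∷ʳ-≤ x V v = begin
    out x (V ∷ʳ v)              ≡⟨ out-↭ x (∷↭∷ʳ v V) ⟨
    ω v * ι (x ⟶? v) + out x V  ≤⟨ +-monoˡ-≤ (out x V) (ω*ι≤ω v (x ⟶? v)) ⟩
    ω v + out x V               ∎
    where open ≤-Reasoning

  second-≤-∷ʳ : ∀ x V v → second x V ≤ second x (V ∷ʳ v)
  second-≤-∷ʳ x V v = begin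
    second x V                         ≤⟨ m≤m+n (second x V) _ ⟩
    second x V + second x (v ∷ [])     ≡⟨ second-++ x V (v ∷ []) ⟨
    second x (V ∷ʳ v)                  ∎
    where open ≤-Reasoning

  -- The total weight of forward arcs, an arc counting the product of the weights of its ends.
  W : List (Fin n) → ℕ
  W []       = 0
  W (x ∷ xs) = ω x * out x xs + W xs

  Median : List (Fin n) → Set
  Median L = ∀ {L′} → L′ ↭ L → W L′ ≤ W L

  W-bounded : ∀ L → W L ≤ ∑ L ω * ∑ L ω
  W-bounded []       = z≤n
  W-bounded (x ∷ xs) = begin
    ω x * out x xs + W xs      ≤⟨ +-mono-≤ (*-monoʳ-≤ (ω x) (∑-mono (λ v → ω*ι≤ω v (x ⟶? v)) xs)) (W-bounded xs) ⟩
    ω x * s + s * s            ≡⟨ *-distribʳ-+ s (ω x) s ⟨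
    (ω x + s) * s              ≤⟨ *-monoʳ-≤ (ω x + s) (m≤n+m s (ω x)) ⟩
    (ω x + s) * (ω x + s)      ∎
    where
    open ≤-Reasoning
    s = ∑ xs ω

  -- Under double negation, an order that is not median can be exchanged for a strictly heavier one,
  -- and `W-bounded` stops this. The double negation is removed at the end, where the goal is
  -- decidable.
  ¬¬-median-exists : ∀ L → ¬ ¬ (∃[ L′ ] L′ ↭ L × Median L′)
  ¬¬-median-exists L none = climb bound L ↭-refl (m≤n+m bound (W L))
    where
    bound = ∑ L ω * ∑ L ω
    -- `k` is fuel: `W X` is at most `k` below `bound`, and every exchange uses up at least one
    -- unit.
    climb : ∀ k X → X ↭ L → bound ≤ W X + k → ⊥
    climb k X p near = none (X , p , median k near)
      where
      median : ∀ k → bound ≤ W X + k → Median X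
      median k near {X′} q with W X′ ≤? W X
      ... | yes le = le
      median zero near {X′} q | no _ = ≤-trans
        (subst (λ s → W X′ ≤ s * s) (∑-↭ ω (↭-trans q p)) (W-bounded X′))
        (subst (bound ≤_) (+-identityʳ (W X)) near)
      median (suc k) near {X′} q | no ≰ = contradiction
        (≤-trans near (≤-trans (≤-reflexive (+-suc (W X) k)) (+-monoˡ-≤ k (≰⇒> ≰))))
        (climb k X′ (↭-trans q p))

  W-∷ : ∀ x {X Y} → X ↭ Y → W X ≡ W Y → W (x ∷ X) ≡ W (x ∷ Y)
  W-∷ x p e = cong₂ _+_ (cong (ω x *_) (out-↭ x p)) e

  -- The weight from `x` to the tail does not depend on the order of the tail.
  median-tail : ∀ x {X} → Median (x ∷ X) → Median X
  median-tail x {X} med {X′} p = +-cancelˡ-≤ (ω x * out x X) _ _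
    (subst (λ o → ω x * o + W X′ ≤ W (x ∷ X)) (out-↭ x p) (med (prep x p)))

  median-suffix : ∀ P {X} → Median (P ++ X) → Median X
  median-suffix []      med = med
  median-suffix (x ∷ P) med = median-suffix P (median-tail x med)

  median-≡ : ∀ {L L′} → L′ ↭ L → W L ≡ W L′ → Median L → Median L′
  median-≡ {L} {L′} p e med q = subst (_ ≤_) e (med (↭-trans q p))

  -- Only the arcs between `b` and `V` change direction: those into `b` are lost, those out of `b`
  -- are gained. Keeping both amounts as summands avoids subtraction.
  W-move : ∀ V b R →
    W (V ++ b ∷ R) + ω b * out b V ≡ W (b ∷ V ++ R) + ω b * into b V
  W-move []      b R = refl
  W-move (v ∷ V) b R = begin
    ω v * out v (V ++ b ∷ R) + W (V ++ b ∷ R) + ω b * (ω v * p + out b V)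
      ≡⟨ cong (λ o → ω v * o + W (V ++ b ∷ R) + ω b * (ω v * p + out b V)) (out-↭ v (shift b V R)) ⟩
    ω v * (ω b * q + o) + W (V ++ b ∷ R) + ω b * (ω v * p + out b V)
      ≡⟨ eq₁ (ω v) (ω b) p q o (W (V ++ b ∷ R)) (out b V) ⟩
    (W (V ++ b ∷ R) + ω b * out b V) + (ω v * ω b * (p + q) + ω v * o)
      ≡⟨ cong (_+ (ω v * ω b * (p + q) + ω v * o)) (W-move V b R) ⟩
    (ω b * out b (V ++ R) + W (V ++ R) + ω b * into b V) + (ω v * ω b * (p + q) + ω v * o)
      ≡⟨ eq₂ (ω v) (ω b) p q o (W (V ++ R)) (out b (V ++ R)) (into b V) ⟩
    ω b * (ω v * p + out b (V ++ R)) + (ω v * o + W (V ++ R)) + ω b * (ω v * q + into b V) ∎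
    where
    open ≡-Reasoning
    p = ι (b ⟶? v)
    q = ι (v ⟶? b)
    o = out v (V ++ R)
    eq₁ : ∀ x y p q o w t → x * (y * q + o) + w + y * (x * p + t) ≡ (w + y * t) + (x * y * (p + q) + x * o)
    eq₁ = solve-∀
    eq₂ : ∀ x y p q o w t i →
      (y * t + w + y * i) + (x * y * (p + q) + x * o) ≡ y * (x * p + t) + (x * o + w) + y * (x * q + i)
    eq₂ = solve-∀

  W-∷ʳ : ∀ V b → W (V ∷ʳ b) ≡ W V + ω b * into b V
  W-∷ʳ V b = +-cancelʳ-≡ (ω b * out b V) _ _ (begin
    W (V ∷ʳ b) + ω b * out b V                   ≡⟨ W-move V b [] ⟩
    ω b * out b (V ++ []) + W (V ++ []) + ω b * into b V
      ≡⟨ cong (λ U → ω b * out b U + W U + ω b * into b V) (++-identityʳ V) ⟩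
    ω b * out b V + W V + ω b * into b V         ≡⟨ rotate (ω b * out b V) (W V) (ω b * into b V) ⟩
    W V + ω b * into b V + ω b * out b V         ∎)
    where
    open ≡-Reasoning
    rotate : ∀ a b c → a + b + c ≡ b + c + a
    rotate = solve-∀

  -- Otherwise moving `b` in front of `V` would increase `W`.
  feedback : ∀ V b R → Median (V ++ b ∷ R) → out b V ≤ into b V
  feedback V b R med = *-cancelˡ-≤ (ω b) {{>-nonZero (ω>0 b)}}
    (+-cancelˡ-≤ (W (V ++ b ∷ R)) _ _ (begin
      W (V ++ b ∷ R) + ω b * out b V   ≡⟨ W-move V b R ⟩
      W (b ∷ V ++ R) + ω b * into b V  ≤⟨ +-monoˡ-≤ (ω b * into b V) (med (↭-sym (shift b V R))) ⟩
      W (V ++ b ∷ R) + ω b * into b V  ∎))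
    where open ≤-Reasoning

  W-move-balanced : ∀ V b R → out b V ≡ into b V → W (V ++ b ∷ R) ≡ W (b ∷ V ++ R)
  W-move-balanced V b R e = +-cancelʳ-≡ (ω b * out b V) _ _
    (trans (W-move V b R) (cong (λ i → W (b ∷ V ++ R) + ω b * i) (sym e)))

  W-∷ʳ-cong : ∀ {V V′} b → V′ ↭ V → W V ≡ W V′ → W (V ∷ʳ b) ≡ W (V′ ∷ʳ b)
  W-∷ʳ-cong {V} {V′} b p e = begin
    W (V ∷ʳ b)               ≡⟨ W-∷ʳ V b ⟩
    W V + ω b * into b V     ≡⟨ cong₂ (λ w i → w + ω b * i) e (into-↭ b (↭-sym p)) ⟩
    W V′ + ω b * into b V′   ≡⟨ W-∷ʳ V′ b ⟨
    W (V′ ∷ʳ b)              ∎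
    where open ≡-Reasoning

  median-init : ∀ V b → Median (V ∷ʳ b) → Median V
  median-init V b med {V′} p = +-cancelʳ-≤ (ω b * into b V) _ _ (begin
    W V′ + ω b * into b V   ≡⟨ cong (λ i → W V′ + ω b * i) (into-↭ b p) ⟨
    W V′ + ω b * into b V′  ≡⟨ W-∷ʳ V′ b ⟨
    W (V′ ∷ʳ b)             ≤⟨ med (++⁺ʳ (b ∷ []) p) ⟩
    W (V ∷ʳ b)              ≡⟨ W-∷ʳ V b ⟩
    W V + ω b * into b V    ∎)
    where open ≤-Reasoning

  -- Bad vertices and sedimentation

  Bad : Fin n → Pred (Fin n) 0ℓ
  Bad f r = r ⟶ f × ¬ f ⇉ r

  -- Opaque, so that abstracting over bad? f r reduces filters.
  opaque
    bad? : ∀ f → Decidable₁ (Bad f)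
    bad? f r = (r ⟶? f) ×-dec ¬? (f ⇉? r)

  -- An arc from `u` to `r` would make `r` a second out-neighbour of `f`, and `u ~ r` would turn
  -- `f ⟶ u` into `f ⟶ r`.
  bad-out : ∀ {f r u} → Bad f r → f ⟶ u → r ⟶ u
  bad-out {f} {r} {u} (r⟶f , ¬f⇉r) f⟶u with trichotomy u r
  ... | inj₁ u~r        = contradiction (respʳ u~r f⟶u) (asym r⟶f)
  ... | inj₂ (inj₁ u⟶r) = contradiction (r⟶f , u , f⟶u , u⟶r) ¬f⇉r
  ... | inj₂ (inj₂ r⟶u) = r⟶u

  good-in : ∀ {f z} → ¬ Bad f z → z ⟶ f → f ⇉ z
  good-in {f} {z} ¬bad z⟶f with f ⇉? z
  ... | yes f⇉z  = f⇉z
  ... | no  ¬f⇉z = contradiction (z⟶f , ¬f⇉z) ¬bad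

  -- If `z` were equivalent to `f` or an out-neighbour of `f`, then `r`, which dominates `f` and its
  -- out-neighbours, would dominate `z`. Hence `z ⟶ f`, and `z` is not bad.
  good-in-bad : ∀ {f r z} → Bad f r → ¬ Bad f z → z ⟶ r → f ⇉ z
  good-in-bad {f} {r} {z} bad-r@(r⟶f , _) ¬bad-z z⟶r with trichotomy f z
  ... | inj₁ f~z        = contradiction (respʳ f~z r⟶f) (asym z⟶r)
  ... | inj₂ (inj₁ f⟶z) = contradiction (bad-out bad-r f⟶z) (asym z⟶r)
  ... | inj₂ (inj₂ z⟶f) = good-in ¬bad-z z⟶f

  out≤out-bad : ∀ {f r} → Bad f r → ∀ V → out f V ≤ out r V
  out≤out-bad {f} {r} bad-r = ∑-mono λ v →
    *-monoʳ-≤ (ω v) (ι-mono (f ⟶? v) (r ⟶? v) (bad-out bad-r))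

  into≤second : ∀ {f V} → All (¬_ ∘ Bad f) V → into f V ≤ second f V
  into≤second {f} ¬bads = ∑-mono-All (All.map (λ {v} ¬bad →
    *-monoʳ-≤ (ω v) (ι-mono (v ⟶? f) (f ⇉? v) (good-in ¬bad))) ¬bads)

  into-bad≤second : ∀ {f r V} → Bad f r → All (¬_ ∘ Bad f) V → into r V ≤ second f V
  into-bad≤second {f} {r} bad-r ¬bads = ∑-mono-All (All.map (λ {v} ¬bad →
    *-monoʳ-≤ (ω v) (ι-mono (v ⟶? r) (f ⇉? v) (good-in-bad bad-r ¬bad))) ¬bads)

  goods bads : Fin n → List (Fin n) → List (Fin n)
  goods f = filter (¬? ∘ bad? f)
  bads  f = filter (bad? f)

  bads-goods : ∀ f R → bads f R ++ goods f R ↭ R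
  bads-goods f []      = ↭-refl
  bads-goods f (r ∷ R) with bad? f r
  ... | yes _ = prep r (bads-goods f R)
  ... | no  _ = ↭-trans (shift r (bads f R) (goods f R)) (prep r (bads-goods f R))

  sediment-↭ : ∀ f V R → bads f R ++ f ∷ V ++ goods f R ↭ V ++ R ∷ʳ f
  sediment-↭ f V R = begin
    bads f R ++ f ∷ V ++ goods f R    ↭⟨ shift f (bads f R) (V ++ goods f R) ⟩
    f ∷ bads f R ++ V ++ goods f R    ↭⟨ prep f (shifts (bads f R) V) ⟩
    f ∷ V ++ bads f R ++ goods f R    ↭⟨ prep f (++⁺ˡ V (bads-goods f R)) ⟩
    f ∷ V ++ R                        ↭⟨ ∷↭∷ʳ f (V ++ R) ⟩
    (V ++ R) ∷ʳ f                     ≡⟨ ++-assoc V R (f ∷ []) ⟩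
    V ++ R ∷ʳ f                       ∎
    where
    open PermutationReasoning

  module _ (f : Fin n) where

    -- `V` collects the vertices already passed while the recursion runs along `R`; the intended
    -- instance has empty `V`. The equality of weights is what keeps the sedimented order median.
    Sedimented : List (Fin n) → List (Fin n) → Set
    Sedimented V R =
      out f (V ++ R) < second f (V ++ R) ⊎
      (out f (V ++ R) ≡ second f (V ++ R) ×
       W (V ++ R ∷ʳ f) ≡ W (bads f R ++ f ∷ V ++ goods f R))

    sedimented⇒≤ : ∀ V R → Sedimented V R → out f (V ++ R) ≤ second f (V ++ R)
    sedimented⇒≤ _ _ (inj₁ lt)      = <⇒≤ lt
    sedimented⇒≤ _ _ (inj₂ (e , _)) = ≤-reflexive e

    -- A bad r in the order dominates every out-neighbour of f and is dominated,
    -- among the vertices V before it, only by second out-neighbours of f.  So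
    -- out f V ≤ out r V ≤ into r V ≤ second f V by the feedback property of r,
    -- and in case of equality r can be moved in front of V.
    sediment : ∀ V R → All (¬_ ∘ Bad f) V → Median (V ++ R ∷ʳ f) → Sedimented V R
    -- No bad vertex is left, so the feedback property of `f` itself takes over; in case of equality
    -- `f` moves to the front.
    sediment V [] ¬bads med rewrite ++-identityʳ V
      with m≤n⇒m<n∨m≡n (≤-trans (feedback V f [] med) (into≤second ¬bads))
    ... | inj₁ lt = inj₁ lt
    ... | inj₂ e  = inj₂ (e , trans (W-move-balanced V f [] balanced) (cong (W ∘ (f ∷_)) (++-identityʳ V)))
      where
      balanced : out f V ≡ into f V
      balanced = ≤-antisym (feedback V f [] med) (≤-trans (into≤second ¬bads) (≤-reflexive (sym e)))
    sediment V (r ∷ R) ¬bads med with bad? f r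
    ... | no ¬bad-r
      rewrite sym (++-assoc V (r ∷ []) R) | sym (++-assoc V (r ∷ []) (R ∷ʳ f))
            | sym (++-assoc V (r ∷ []) (goods f R))
      = sediment (V ∷ʳ r) R (∷ʳ⁺ ¬bads ¬bad-r) med
    ... | yes bad-r@(r⟶f , _) = step (m≤n⇒m<n∨m≡n (≤-trans out≤into into≤sec))
      where
      out≤into : out f V ≤ into r V
      out≤into = ≤-trans (out≤out-bad bad-r V) (feedback V r (R ∷ʳ f) med)
      into≤sec : into r V ≤ second f V
      into≤sec = into-bad≤second bad-r ¬bads
      out-∷ : ∀ U → out f (r ∷ U) ≡ out f U
      out-∷ U rewrite ι-no (f ⟶? r) (asym r⟶f) | *-zeroʳ (ω r) = refl
      out-drop : out f (V ++ r ∷ R) ≡ out f (V ++ R)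
      out-drop = trans (out-↭ f (shift r V R)) (out-∷ (V ++ R))
      second-drop : second f (V ++ r ∷ R) ≡ second f (V ++ R)
      second-drop rewrite second-↭ f (shift r V R)
                        | ι-no (f ⇉? r) (proj₂ bad-r) | *-zeroʳ (ω r) = refl
      -- The chain `into r V ≤ second f V = out f V ≤ out r V` turns the feedback inequality of `r`
      -- into an equality.
      moved : out f V ≡ second f V → W (V ++ r ∷ R ∷ʳ f) ≡ W (r ∷ V ++ R ∷ʳ f)
      moved e = W-move-balanced V r (R ∷ʳ f) (≤-antisym (feedback V r (R ∷ʳ f) med)
        (≤-trans into≤sec (≤-trans (≤-reflexive (sym e)) (out≤out-bad bad-r V))))
      step : out f V < second f V ⊎ out f V ≡ second f V → _
      -- `V` already gains strictly, and `r` contributes to neither side. The rest `R ∷ʳ f` is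
      -- median as a suffix, so a fresh sedimentation gives its weak inequality.
      step (inj₁ lt) = inj₁ (begin-strict
        out f (V ++ r ∷ R)           ≡⟨ out-drop ⟩
        out f (V ++ R)               ≡⟨ out-++ f V R ⟩
        out f V + out f R            <⟨ +-mono-<-≤ lt (sedimented⇒≤ [] R (sediment [] R []
                                          (median-tail r (median-suffix V med)))) ⟩
        second f V + second f R      ≡⟨ second-++ f V R ⟨
        second f (V ++ R)            ≡⟨ second-drop ⟨
        second f (V ++ r ∷ R)        ∎)
        where open ≤-Reasoning
      -- With `r` moved to the front, the order behind it is median, and the scan goes on with the
      -- same `V`.
      step (inj₂ e) with sediment V R ¬bads (median-tail r (median-≡ (↭-sym (shift r V (R ∷ʳ f))) (moved e) med))
      ... | inj₁ lt       = inj₁ (subst₂ _<_ (sym out-drop) (sym second-drop) lt)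
      ... | inj₂ (e₁ , e₂) = inj₂
        ( trans out-drop (trans e₁ (sym second-drop))
        , trans (moved e) (W-∷ r (↭-sym (sediment-↭ f V R)) e₂))

  -- The last two vertices form a median order by themselves, where an arc `f ⟶ y` would violate the
  -- feedback property of `f`.
  penultimate-arc : ∀ V {y f} → Median (V ++ y ∷ f ∷ []) → ¬ y ~ f → y ⟶ f
  penultimate-arc V {y} {f} med y≁f with trichotomy y f
  ... | inj₁ y~f        = contradiction y~f y≁f
  ... | inj₂ (inj₁ y⟶f) = y⟶f
  ... | inj₂ (inj₂ f⟶y) = contradiction (feedback (y ∷ []) f [] (median-suffix V med)) (<⇒≱ into<out)
    where
    into<out : into f (y ∷ []) < out f (y ∷ [])
    into<out rewrite ι-yes (f ⟶? y) f⟶y | ι-no (y ⟶? f) (asym f⟶y) =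
      +-monoˡ-< 0 (*-monoʳ-< (ω y) {{>-nonZero (ω>0 y)}} (s≤s z≤n))

  -- x is never bad for the feed y, since y ⟶ f ⟶ x; so as long as the second
  -- neighbourhood of y is not strictly larger, sedimentation brings x nearer
  -- to the end of the order.
  sinking-sediment : ∀ k {f x} pre post → length post ≤ k → f ⟶ x →
    All (λ z → ¬ z ~ f) (pre ++ x ∷ post) → Median ((pre ++ x ∷ post) ∷ʳ f) →
    ∃[ y ] y ⟶ f × out y (pre ++ x ∷ post) < second y (pre ++ x ∷ post)
  sinking-sediment k {f} {x} pre post len f⟶x ≁f med with initLast post
  -- Here `x` itself is penultimate, which forces `x ⟶ f`.
  ... | [] = contradiction f⟶x (asym (penultimate-arc pre
    (subst Median (++-assoc pre (x ∷ []) (f ∷ [])) med)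
    (All.head (++⁻ʳ pre ≁f))))
  sinking-sediment zero {f} {x} pre _ len f⟶x ≁f med | ws ∷ʳ′ y =
    contradiction (subst (_≤ 0) (trans (length-++ ws) (+-comm (length ws) 1)) len) λ ()
  sinking-sediment (suc k) {f} {x} pre _ len f⟶x ≁f med | ws ∷ʳ′ y
    rewrite sym (++-assoc pre (x ∷ ws) (y ∷ []))
    = settle (sediment y [] R [] (median-init (R ∷ʳ y) f med))
    where
    R = pre ++ x ∷ ws
    y⟶f : y ⟶ f
    y⟶f = penultimate-arc R (subst Median (++-assoc R (y ∷ []) (f ∷ [])) med)
      (All.head (++⁻ʳ R ≁f))
    -- The middle vertex in `_⇉_` ranges over all vertices, so `f` counts although it has been taken
    -- off the order.
    ¬bad-x : ¬ Bad y x
    ¬bad-x (x⟶y , ¬y⇉x) = ¬y⇉x (x⟶y , f , y⟶f , f⟶x)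
    pre′ = bads y R ++ y ∷ goods y pre
    post′ = goods y ws
    -- `x` is kept among the goods, while `y`, which stood behind it, goes in front; hence `post′`
    -- is shorter than `ws ∷ʳ y`.
    sedimented≡ : bads y R ++ y ∷ goods y R ≡ pre′ ++ x ∷ post′
    sedimented≡ = begin
      bads y R ++ y ∷ goods y R
        ≡⟨ cong (λ G → bads y R ++ y ∷ G) (filter-++ (¬? ∘ bad? y) pre (x ∷ ws)) ⟩
      bads y R ++ y ∷ goods y pre ++ goods y (x ∷ ws)
        ≡⟨ cong (λ G → bads y R ++ y ∷ goods y pre ++ G) (filter-accept (¬? ∘ bad? y) ¬bad-x) ⟩
      bads y R ++ (y ∷ goods y pre) ++ x ∷ post′
        ≡⟨ ++-assoc (bads y R) (y ∷ goods y pre) (x ∷ post′) ⟨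
      pre′ ++ x ∷ post′ ∎
      where open ≡-Reasoning
    perm : pre′ ++ x ∷ post′ ↭ R ∷ʳ y
    perm = subst (_↭ R ∷ʳ y) sedimented≡ (sediment-↭ y [] R)
    len′ : length post′ ≤ k
    len′ = ≤-trans (length-filter (¬? ∘ bad? y) ws)
      (≤-pred (subst (_≤ suc k) (trans (length-++ ws) (+-comm (length ws) 1)) len))
    settle : Sedimented y [] R → ∃[ u ] u ⟶ f × out u (R ∷ʳ y) < second u (R ∷ʳ y)
    settle (inj₁ lt) = y , y⟶f , (begin-strict
      out y (R ∷ʳ y)     ≡⟨ out-∷ʳ-self y R ⟩
      out y R            <⟨ lt ⟩
      second y R         ≤⟨ second-≤-∷ʳ y R y ⟩
      second y (R ∷ʳ y)  ∎)
      where open ≤-Reasoning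
    -- Appending `f` again gives a median order, because the weight into `f` ignores the order
    -- before it.
    settle (inj₂ (_ , e)) with sinking-sediment k pre′ post′ len′ f⟶x
      (All-resp-↭ (↭-sym perm) ≁f)
      (median-≡ (++⁺ʳ (f ∷ []) perm)
        (W-∷ʳ-cong f perm (trans e (cong W sedimented≡))) med)
    ... | u , u⟶f , lt = u , u⟶f , subst₂ _<_ (out-↭ u perm) (second-↭ u perm) lt

-- Second out-neighbourhoods and the sets J(x)

module SecondNeighbourhoods {n : ℕ} (D : OrientedGraph n) where
  open OrientedGraph D
  open Neighbourhoods D

  IsSecond : Rel (Fin n) 0ℓ
  IsSecond p v = v ∉ N⁺ p ∪ ⁅ p ⁆ × ∃[ u ] u ∈ N⁺ p × u ⟶ v

  isSecond? : Decidable IsSecond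
  isSecond? p v = ¬? (v ∈? (N⁺ p ∪ ⁅ p ⁆)) ×-dec any? (λ u → (u ∈? N⁺ p) ×-dec (u ⟶? v))

  ∈-N⁺⁺⁺ : ∀ {p v} → IsSecond p v → v ∈ N⁺⁺ p
  ∈-N⁺⁺⁺ {p} = ∈-comprehension⁺ (isSecond? p)

  ∈-N⁺⁺⁻ : ∀ {p v} → v ∈ N⁺⁺ p → IsSecond p v
  ∈-N⁺⁺⁻ {p} = ∈-comprehension⁻ (isSecond? p)

module Classes {n : ℕ} (D : OrientedGraph n) where
  open Neighbourhoods D
  open Dependency D

  -- Opaque (like joined below), since otherwise every with-abstraction in a
  -- context mentioning K𝓘 normalises the decision procedure for ≈𝓘.
  opaque
    Together : Rel (Fin n) 0ℓ
    Together x y = ∃[ ξ ] x ∈ K𝓘 ξ × y ∈ K𝓘 ξ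

    joined : Fin n → Subset n
    joined x = comprehension λ y → anyMissing? λ ξ → (x ∈? K𝓘 ξ) ×-dec (y ∈? K𝓘 ξ)

    joined-def : ∀ x →
      (comprehension λ y → anyMissing? λ ξ → (x ∈? K𝓘 ξ) ×-dec (y ∈? K𝓘 ξ)) ≡ joined x
    joined-def x = refl

    ∈-joined⁺ : ∀ {x y} → Together x y → y ∈ joined x
    ∈-joined⁺ {x} =
      ∈-comprehension⁺ λ y → anyMissing? λ ξ → (x ∈? K𝓘 ξ) ×-dec (y ∈? K𝓘 ξ)

    ∈-joined⁻ : ∀ {x y} → y ∈ joined x → Together x y
    ∈-joined⁻ {x} =
      ∈-comprehension⁻ λ y → anyMissing? λ ξ → (x ∈? K𝓘 ξ) ×-dec (y ∈? K𝓘 ξ)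

    together-edge : ∀ {x y e} → x ∈ᵉ e → y ∈ᵉ e → Together x y
    together-edge {e = e} x∈e y∈e = e , ∈K𝓘 x∈e , ∈K𝓘 y∈e
      where
      ∈K𝓘 : ∀ {x} → x ∈ᵉ e → x ∈ K𝓘 e
      ∈K𝓘 x∈e = ∈-comprehension⁺ (liesOn𝓘? e)
        (e , ε , ∈-comprehension⁺ (liesOn? e) (e , ε , x∈e))

    together⇒¬whole : ∀ {x y} → Together x y → ¬ Whole x
    together⇒¬whole (ξ , x∈ , _) whole =
      let C , _ , x∈C = ∈-comprehension⁻ (liesOn𝓘? ξ) x∈
          e , _ , x∈e = ∈-comprehension⁻ (liesOn? C) x∈C
      in whole e x∈e

    together-sym : ∀ {x y} → Together x y → Together y x
    together-sym (ξ , x∈ , y∈) = ξ , y∈ , x∈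

    together-trans : ∀ {x y z} → Together x y → Together y z → Together x z
    together-trans (ξ , x∈ , y∈) (ξ′ , y∈′ , z∈′) =
      let C , p , z∈C = ∈-comprehension⁻ (liesOn𝓘? ξ′) z∈′
      in ξ , x∈ , ∈-comprehension⁺ (liesOn𝓘? ξ) (C , K𝓘-unique y∈ y∈′ ◅◅ p , z∈C)

  -- The interval property without mention of `K𝓘`. A set `K` within the class of `x` is enough,
  -- since arcs are only transported at vertices outside the class.
  TogetherInterval : Set
  TogetherInterval = ∀ {x y} → Together x y →
    ∃[ K ] (∀ {z} → z ∈ K → Together x z) × N⁺ x ─ K ≡ N⁺ y ─ K × N⁻ x ─ K ≡ N⁻ y ─ K

  opaque
    unfolding Together

    together-interval : Good → TogetherInterval
    together-interval good {x} {y} (ξ , x∈ , y∈) =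
      K𝓘 ξ , (λ z∈ → ξ , x∈ , z∈) , good ξ x y x∈ y∈

  -- The two cases in the definition of `J`, as data, so that proofs can split on them without
  -- evaluating `J`.
  data Class (x : Fin n) (S : Subset n) : Set where
    single : Whole x → S ≡ ⁅ x ⁆ → Class x S
    joint  : ¬ Whole x → S ≡ joined x → Class x S

  data Location (x : Fin n) : Set where
    onEdge : ∀ e → x ∈ᵉ e → Location x
    whole  : Whole x → Location x

  opaque
    locate : ∀ x → Location x
    locate x = fromDec (anyMissing? (x ∈ᵉ?_))
      where
      fromDec : Dec (∃[ e ] x ∈ᵉ e) → Location x
      fromDec (yes (e , x∈e)) = onEdge e x∈e
      fromDec (no none)       = whole λ e x∈e → none (e , x∈e)

  J-class : ∀ x → Class x (J x)
  J-class x with whole? x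
  ... | yes w  = single w refl
  ... | no  ¬w = joint ¬w (joined-def x)

-- C stands for J, which is thereby never unfolded during type checking.
module GoodDigraph
  {n : ℕ} (D : OrientedGraph n) (interval : Classes.TogetherInterval D)
  (C : Fin n → Subset n) (class : ∀ x → Classes.Class D x (C x))
  where
  open OrientedGraph D
  open Neighbourhoods D
  open Dependency D hiding (J)
  open Classes D
  open SecondNeighbourhoods D

  -- The weighted quotient tournament

  infix 4 _~_ _~?_

  _~_ : Rel (Fin n) 0ℓ
  x ~ y = y ∈ C x

  _~?_ : Decidable _~_
  x ~? y = y ∈? C x

  ~⁺ : ∀ {x y} → Together x y → x ~ y
  ~⁺ {x} {y} t with class x
  ... | single w _ = contradiction w (together⇒¬whole t)
  ... | joint _ eq = subst (y ∈_) (sym eq) (∈-joined⁺ t)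

  ~⁻ : ∀ {x y} → x ~ y → x ≡ y ⊎ Together x y
  ~⁻ {x} {y} m with class x
  ... | single _ eq = inj₁ (sym (x∈⁅y⁆⇒x≡y x (subst (y ∈_) eq m)))
  ... | joint _ eq  = inj₂ (∈-joined⁻ (subst (y ∈_) eq m))

  C-whole : ∀ {x} → Whole x → C x ≡ ⁅ x ⁆
  C-whole {x} w with class x
  ... | single _ eq = eq
  ... | joint ¬w _  = contradiction w ¬w

  ~-refl : ∀ {x} → x ~ x
  ~-refl {x} with locate x
  ... | onEdge e x∈e = ~⁺ (together-edge {e = e} x∈e x∈e)
  ... | whole w      = subst (x ∈_) (sym (C-whole w)) (x∈⁅x⁆ x)

  ~-sym : ∀ {x y} → x ~ y → y ~ x
  ~-sym x~y with ~⁻ x~y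
  ... | inj₁ refl = ~-refl
  ... | inj₂ t    = ~⁺ (together-sym t)

  ~-trans : ∀ {x y z} → x ~ y → y ~ z → x ~ z
  ~-trans x~y y~z with ~⁻ x~y | ~⁻ y~z
  ... | inj₁ refl | _         = y~z
  ... | inj₂ t    | inj₁ refl = x~y
  ... | inj₂ t    | inj₂ t′   = ~⁺ (together-trans t t′)

  ~-decSetoid : DecSetoid 0ℓ 0ℓ
  ~-decSetoid = record
    { isDecEquivalence = record
      { isEquivalence = record { refl = ~-refl ; sym = ~-sym ; trans = ~-trans }
      ; _≟_ = _~?_ } }

  interval-out : ∀ {x y z} → x ~ y → ¬ x ~ z → x ⟶ z → y ⟶ z
  interval-out {x} {y} {z} x~y x≁z x⟶z with ~⁻ x~y
  ... | inj₁ refl = x⟶z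
  ... | inj₂ t with interval t
  ...   | K , K⇒x , N⁺≡ , _ = ∈-comprehension⁻ (y ⟶?_) (p─q⊆p (N⁺ y) K
    (subst (z ∈_) N⁺≡ (x∈p∧x∉q⇒x∈p─q (∈-comprehension⁺ (x ⟶?_) x⟶z) (x≁z ∘ ~⁺ ∘ K⇒x))))

  interval-in : ∀ {x y z} → x ~ y → ¬ x ~ z → z ⟶ x → z ⟶ y
  interval-in {x} {y} {z} x~y x≁z z⟶x with ~⁻ x~y
  ... | inj₁ refl = z⟶x
  ... | inj₂ t with interval t
  ...   | K , K⇒x , _ , N⁻≡ = ∈-comprehension⁻ (_⟶? y) (p─q⊆p (N⁻ y) K
    (subst (z ∈_) N⁻≡ (x∈p∧x∉q⇒x∈p─q (∈-comprehension⁺ (_⟶? x) z⟶x) (x≁z ∘ ~⁺ ∘ K⇒x))))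

  -- The arcs of the quotient of D by ~, on representatives of its vertices.
  _⟶ᵠ_ : Rel (Fin n) 0ℓ
  x ⟶ᵠ y = ¬ x ~ y × x ⟶ y

  _⟶ᵠ?_ : Decidable _⟶ᵠ_
  x ⟶ᵠ? y = ¬? (x ~? y) ×-dec (x ⟶? y)

  ⟶ᵠ-asym : Asymmetric _⟶ᵠ_
  ⟶ᵠ-asym (_ , x⟶y) (_ , y⟶x) = asym x⟶y y⟶x

  ⟶ᵠ-respʳ : ∀ {x y z} → x ~ y → z ⟶ᵠ x → z ⟶ᵠ y
  ⟶ᵠ-respʳ x~y (z≁x , z⟶x) =
    (λ z~y → z≁x (~-trans z~y (~-sym x~y))) , interval-in x~y (z≁x ∘ ~-sym) z⟶x

  ⟶ᵠ-respˡ : ∀ {x y z} → x ~ y → x ⟶ᵠ z → y ⟶ᵠ z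
  ⟶ᵠ-respˡ x~y (x≁z , x⟶z) = (λ y~z → x≁z (~-trans x~y y~z)) , interval-out x~y x≁z x⟶z

  -- Distinct non-adjacent vertices form a missing edge, whose ends lie in one class.
  trichotomy : ∀ x y → x ~ y ⊎ x ⟶ᵠ y ⊎ y ⟶ᵠ x
  trichotomy x y with x ~? y | x ⟶? y | y ⟶? x
  ... | yes x~y | _       | _       = inj₁ x~y
  ... | no x≁y  | yes x⟶y | _       = inj₂ (inj₁ (x≁y , x⟶y))
  ... | no x≁y  | no _    | yes y⟶x = inj₂ (inj₂ (x≁y ∘ ~-sym , y⟶x))
  ... | no x≁y  | no x↛y  | no y↛x  with <-cmp x y
  ...   | tri≈ _ refl _ = inj₁ ~-refl
  ...   | tri< x<y _ _ = inj₁ (~⁺ (together-edge {e = e} (inj₁ refl) (inj₂ refl)))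
    where e = missing x y x<y λ { (inj₁ a) → x↛y a ; (inj₂ a) → y↛x a }
  ...   | tri> _ _ y<x = inj₁ (~⁺ (together-edge {e = e} (inj₂ refl) (inj₁ refl)))
    where e = missing y x y<x λ { (inj₁ a) → y↛x a ; (inj₂ a) → x↛y a }

  ω : Fin n → ℕ
  ω x = ∣ C x ∣

  ω-whole : ∀ {x} → Whole x → ω x ≡ 1
  ω-whole {x} w = trans (cong ∣_∣ (C-whole w)) (∣⁅x⁆∣≡1 x)

  ω>0 : ∀ x → 0 < ω x
  ω>0 x = subst (_≤ ω x) (∣⁅x⁆∣≡1 x)
    (p⊆q⇒∣p∣≤∣q∣ λ v∈ → subst (_∈ C x) (sym (x∈⁅y⁆⇒x≡y x v∈)) ~-refl)

  open WeightedTournament _⟶ᵠ_ _⟶ᵠ?_ ⟶ᵠ-asym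
    _~_ ⟶ᵠ-respʳ trichotomy ω ω>0 public

  representatives : List (Fin n)
  representatives = deduplicate _~?_ (allFin n)

  representatives-distinct : AllPairs (λ x y → ¬ x ~ y) representatives
  representatives-distinct = deduplicate-! ~-decSetoid (allFin n)

  representative : ∀ v → Any (v ~_) representatives
  representative v = deduplicate⁺ _~?_ (λ y~x v~x → ~-trans v~x (~-sym y~x))
    (Any.map (λ { refl → ~-refl }) (∈-allFin v))

  -- As `P` is constant on classes, a vertex can be counted at the one representative of its class;
  -- exchanging the sums then produces the class sizes.
  ∑-classes : {P : Pred (Fin n) 0ℓ} (P? : Decidable₁ P) → (∀ {x y} → x ~ y → P x → P y) →
    ∑ (allFin n) (λ v → ι (P? v)) ≡ ∑ representatives (λ r → ω r * ι (P? r))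
  ∑-classes P? P-resp = begin
    ∑ V (λ v → ι (P? v))
      ≡⟨ ∑-cong (λ v → trans (sym (*-identityˡ (ι (P? v)))) (cong (_* ι (P? v)) (sym (unit v)))) V ⟩
    ∑ V (λ v → ∑ R (λ r → ι (r ~? v)) * ι (P? v))
      ≡⟨ ∑-cong (λ v → sym (∑-*ʳ (λ r → ι (r ~? v)) (ι (P? v)) R)) V ⟩
    ∑ V (λ v → ∑ R (λ r → ι (r ~? v) * ι (P? v)))
      ≡⟨ ∑-cong (λ v → ∑-cong (λ r → constant r v) R) V ⟩
    ∑ V (λ v → ∑ R (λ r → ι (r ~? v) * ι (P? r)))
      ≡⟨ ∑-swap (λ v r → ι (r ~? v) * ι (P? r)) V R ⟩
    ∑ R (λ r → ∑ V (λ v → ι (r ~? v) * ι (P? r)))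
      ≡⟨ ∑-cong (λ r → ∑-*ʳ (λ v → ι (r ~? v)) (ι (P? r)) V) R ⟩
    ∑ R (λ r → ∑ V (λ v → ι (r ~? v)) * ι (P? r))
      ≡⟨ ∑-cong (λ r → cong (_* ι (P? r)) (∣∣≡∑ (C r))) R ⟨
    ∑ R (λ r → ω r * ι (P? r)) ∎
    where
    open ≡-Reasoning
    V = allFin n
    R = representatives
    unit : ∀ v → ∑ R (λ r → ι (r ~? v)) ≡ 1
    unit v = ∑-representatives _~?_ ~-sym ~-trans representatives-distinct (representative v)
    constant : ∀ r v → ι (r ~? v) * ι (P? v) ≡ ι (r ~? v) * ι (P? r)
    constant r v with r ~? v
    ... | yes r~v = cong (1 *_) (ι-cong (P? v) (P? r) (P-resp (~-sym r~v)) (P-resp r~v))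
    ... | no  _   = refl

  ⇉-respʳ : ∀ {x y z} → x ~ y → z ⇉ x → z ⇉ y
  ⇉-respʳ x~y (x⟶z , u , z⟶u , u⟶x) =
    ⟶ᵠ-respˡ x~y x⟶z , u , z⟶u , ⟶ᵠ-respʳ x~y u⟶x

  -- Passing from D[J(x)] to D

  module Inside (x : Fin n) where
    open Neighbourhoods (D [ C x ]) public using () renaming
      (N⁺ to N⁺ᶜ; N⁺⁺ to N⁺⁺ᶜ; SecondNeighbourhoodProperty to SecondNeighbourhoodPropertyᶜ)

    arc : ∀ {p v} → v ∈ N⁺ᶜ p → p ∈ C x × v ∈ C x × p ⟶ v
    arc {p} = ∈-comprehension⁻ (OrientedGraph._⟶?_ (D [ C x ]) p)

    arc⁻ : ∀ {p v} → p ∈ C x × v ∈ C x × p ⟶ v → v ∈ N⁺ᶜ p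
    arc⁻ {p} = ∈-comprehension⁺ (OrientedGraph._⟶?_ (D [ C x ]) p)

    -- An arc `p ⟶ v` in `D` would also be an arc inside the class, since `p` lies there, having an
    -- out-neighbour there.
    second-inside : ∀ {p v} → v ∈ N⁺⁺ᶜ p → v ∈ C x × v ∈ N⁺⁺ p
    second-inside {p} {v} v∈ with SecondNeighbourhoods.∈-N⁺⁺⁻ (D [ C x ]) v∈
    ... | v∉ , u , u∈ , u∈C , v∈C , u⟶v = v∈C , ∈-N⁺⁺⁺
      (outside , u , ∈-comprehension⁺ (p ⟶?_) (proj₂ (proj₂ (arc u∈))) , u⟶v)
      where
      outside : v ∉ N⁺ p ∪ ⁅ p ⁆
      outside m with x∈p∪q⁻ (N⁺ p) ⁅ p ⁆ m
      ... | inj₁ v∈N = v∉ (x∈p∪q⁺ (inj₁ (arc⁻ (proj₁ (arc u∈) , v∈C , ∈-comprehension⁻ (p ⟶?_) v∈N))))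
      ... | inj₂ v∈p = v∉ (x∈p∪q⁺ (inj₂ v∈p))

    second-outside : ∀ {p v} → p ∈ C x → x ⇉ v → v ∈ N⁺⁺ p
    second-outside {p} {v} x~p (v⟶x , u , x⟶u , (_ , u⟶v)) = ∈-N⁺⁺⁺
      (outside , u , ∈-comprehension⁺ (p ⟶?_) (proj₂ (⟶ᵠ-respˡ x~p x⟶u)) , u⟶v)
      where
      v⟶p : v ⟶ᵠ p
      v⟶p = ⟶ᵠ-respʳ x~p v⟶x
      outside : v ∉ N⁺ p ∪ ⁅ p ⁆
      outside m with x∈p∪q⁻ (N⁺ p) ⁅ p ⁆ m
      ... | inj₁ v∈N = asym (proj₂ v⟶p) (∈-comprehension⁻ (p ⟶?_) v∈N)
      ... | inj₂ v∈p = irrefl (x∈⁅y⁆⇒x≡y p v∈p) (proj₂ v⟶p)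

    -- Inside the class, `inner` compares the neighbourhoods. Outside it, `p` has the same
    -- out-neighbours as `x` by the interval property, and `outer` applies. The two kinds of second
    -- out-neighbours are disjoint.
    lift : ∀ {p} → p ∈ C x → SecondNeighbourhoodPropertyᶜ p →
      out x representatives ≤ second x representatives → SecondNeighbourhoodProperty p
    lift {p} x~p inner outer = begin
      ∣ N⁺ p ∣
        ≡⟨ ∣∣≡∑ (N⁺ p) ⟩
      ∑ V (λ v → ι (v ∈? N⁺ p))
        ≤⟨ ∑-mono (λ v → ι-cover (v ∈? N⁺ p) (v ∈? N⁺ᶜ p) (x ⟶ᵠ? v) split) V ⟩
      ∑ V (λ v → ι (v ∈? N⁺ᶜ p) + ι (x ⟶ᵠ? v))
        ≡⟨ ∑-+ (λ v → ι (v ∈? N⁺ᶜ p)) (λ v → ι (x ⟶ᵠ? v)) V ⟩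
      ∑ V (λ v → ι (v ∈? N⁺ᶜ p)) + ∑ V (λ v → ι (x ⟶ᵠ? v))
        ≡⟨ cong₂ _+_ (sym (∣∣≡∑ (N⁺ᶜ p))) (∑-classes (x ⟶ᵠ?_) ⟶ᵠ-respʳ) ⟩
      ∣ N⁺ᶜ p ∣ + out x representatives
        ≤⟨ +-mono-≤ inner outer ⟩
      ∣ N⁺⁺ᶜ p ∣ + second x representatives
        ≡⟨ cong₂ _+_ (sym (∣∣≡∑ (N⁺⁺ᶜ p))) (∑-classes (x ⇉?_) ⇉-respʳ) ⟨
      ∑ V (λ v → ι (v ∈? N⁺⁺ᶜ p)) + ∑ V (λ v → ι (x ⇉? v))
        ≡⟨ ∑-+ (λ v → ι (v ∈? N⁺⁺ᶜ p)) (λ v → ι (x ⇉? v)) V ⟨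
      ∑ V (λ v → ι (v ∈? N⁺⁺ᶜ p) + ι (x ⇉? v))
        ≤⟨ ∑-mono (λ v → ι-disjoint (v ∈? N⁺⁺ p) (v ∈? N⁺⁺ᶜ p) (x ⇉? v)
             (proj₂ ∘ second-inside) (second-outside x~p)
             (λ v∈ → λ ((v≁x , _) , _) → v≁x (~-sym (proj₁ (second-inside v∈))))) V ⟩
      ∑ V (λ v → ι (v ∈? N⁺⁺ p))
        ≡⟨ ∣∣≡∑ (N⁺⁺ p) ⟨
      ∣ N⁺⁺ p ∣ ∎
      where
      open ≤-Reasoning
      V = allFin n
      split : ∀ {v} → v ∈ N⁺ p → v ∈ N⁺ᶜ p ⊎ x ⟶ᵠ v
      split {v} v∈ with x ~? v
      ... | yes x~v = inj₁ (arc⁻ (x~p , x~v , ∈-comprehension⁻ (p ⟶?_) v∈))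
      ... | no  x≁v = inj₂ (⟶ᵠ-respˡ (~-sym x~p)
        ((λ p~v → x≁v (~-trans x~p p~v)) , ∈-comprehension⁻ (p ⟶?_) v∈))

    whole-inner : Whole x → SecondNeighbourhoodPropertyᶜ x
    whole-inner w = p⊆q⇒∣p∣≤∣q∣ {p = N⁺ᶜ x} {q = N⁺⁺ᶜ x} λ {v} v∈ →
      let _ , v∈C , x⟶v = arc v∈
      in contradiction x⟶v (irrefl (sym (x∈⁅y⁆⇒x≡y x (subst (v ∈_) (C-whole w) v∈C))))

  open Inside

  -- Two vertices with the property

  secondNeighbourhoodProperty? : Decidable₁ SecondNeighbourhoodProperty
  secondNeighbourhoodProperty? v = ∣ N⁺ v ∣ ≤? ∣ N⁺⁺ v ∣

  feed-out≤second : ∀ zs f → zs ∷ʳ f ↭ representatives → Median (zs ∷ʳ f) →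
    out f representatives ≤ second f representatives
  feed-out≤second zs f perm med = begin
    out f representatives      ≡⟨ out-↭ f perm ⟨
    out f (zs ∷ʳ f)            ≡⟨ out-∷ʳ-self f zs ⟩
    out f zs                   ≤⟨ sedimented⇒≤ f [] zs (sediment f [] zs [] med) ⟩
    second f zs                ≤⟨ second-≤-∷ʳ f zs f ⟩
    second f (zs ∷ʳ f)         ≡⟨ second-↭ f perm ⟩
    second f representatives   ∎
    where open ≤-Reasoning

  module _
    (noSink : ∀ v → ¬ Sink v)
    (inner : ∀ x → (∃[ e ] x ∈ᵉ e) →
      AtLeastTwo (λ p → p ∈ C x × SecondNeighbourhoodPropertyᶜ x p))
    where

    innerWitness : ∀ x → ∃[ p ] p ∈ C x × SecondNeighbourhoodPropertyᶜ x p
    innerWitness x with locate x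
    ... | onEdge e x∈e = let p , _ , _ , p-inner , _ = inner x (e , x∈e) in p , p-inner
    ... | whole w      = x , ~-refl , whole-inner x w

    out-neighbour : ∀ v → ∃[ w ] v ⟶ w
    out-neighbour v with any? (v ⟶?_)
    ... | yes found = found
    ... | no  none  = contradiction
      (n≤0⇒n≡0 (subst (∣ N⁺ v ∣ ≤_) (∣⊥∣≡0 n)
        (p⊆q⇒∣p∣≤∣q∣ {p = N⁺ v} {q = ∅} λ w∈ → contradiction (_ , ∈-comprehension⁻ (v ⟶?_) w∈) none)))
      (noSink v)

    -- Since `f` is no sink and is alone in its class, it has an out-neighbour in another class,
    -- whose representative stands before `f`. This supplies the `x` of `sinking-sediment`.
    whole-feed-out : ∀ {zs f} → Whole f → zs ∷ʳ f ↭ representatives →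
      ∃[ r ] r ∈ˡ zs × f ⟶ᵠ r
    whole-feed-out {zs} {f} w₀ perm =
      r , inOrder (∈-++⁻ zs (∈-resp-↭ (↭-sym perm) (proj₁ (proj₂ rep)))) , f⟶r
      where
      w = proj₁ (out-neighbour f)
      f⟶w : f ⟶ w
      f⟶w = proj₂ (out-neighbour f)
      rep = find (representative w)
      r = proj₁ rep
      f≁w : ¬ f ~ w
      f≁w f~w = irrefl (sym (x∈⁅y⁆⇒x≡y f (subst (w ∈_) (C-whole w₀) f~w))) f⟶w
      f⟶r : f ⟶ᵠ r
      f⟶r = ⟶ᵠ-respʳ (proj₂ (proj₂ rep)) (f≁w , f⟶w)
      inOrder : r ∈ˡ zs ⊎ r ∈ˡ (f ∷ []) → r ∈ˡ zs
      inOrder (inj₁ r∈zs)      = r∈zs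
      inOrder (inj₂ (here r≡f)) = contradiction f⟶r (irreflexive ∘ subst (f ⟶ᵠ_) r≡f)

    feed-distinct : ∀ {zs f} → zs ∷ʳ f ↭ representatives → All (λ z → ¬ z ~ f) zs
    feed-distinct {zs} {f} perm with ↭ₛ.AllPairs-resp-↭ (setoid (Fin n)) (λ x≁y → x≁y ∘ ~-sym)
      (resp₂ (λ x y → ¬ x ~ y))
      (↭⇒↭ₛ (↭-trans (↭-sym perm) (↭-sym (∷↭∷ʳ f zs)))) representatives-distinct
    ... | f≁ ∷ _ = All.map (λ f≁z → f≁z ∘ ~-sym) f≁

    median-two : ∀ zs f → zs ∷ʳ f ↭ representatives → Median (zs ∷ʳ f) →
      AtLeastTwo SecondNeighbourhoodProperty
    median-two zs f perm med with locate f
    ... | onEdge e f∈e =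
      let p , q , p≢q , (f~p , p-inner) , (f~q , q-inner) = inner f (e , f∈e)
      in p , q , p≢q , lift f f~p p-inner feed , lift f f~q q-inner feed
      where feed = feed-out≤second zs f perm med
    ... | whole w with whole-feed-out w perm
    ...   | x , x∈zs , f⟶x with ∈-∃++ x∈zs
    ...     | pre , post , refl
      with sinking-sediment (length post) pre post ≤-refl f⟶x (feed-distinct perm) med
    ...       | y , y⟶f , out<second with innerWitness y
    ...         | p , y~p , p-inner =
      -- `p` lies in the class of `y`, which is not the class of `f`.
      f , p , (λ { refl → proj₁ y⟶f y~p }) ,
      lift f ~-refl (whole-inner f w) (feed-out≤second zs f perm med) ,
      lift y y~p p-inner (begin
        out y representatives      ≡⟨ out-↭ y perm ⟨
        out y (zs ∷ʳ f)            ≤⟨ out-∷ʳ-≤ y zs f ⟩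
        -- Putting `f` back costs `ω f`, which is 1 as `f` is whole; the strict inequality for `y`
        -- pays for it.
        ω f + out y zs             ≡⟨ cong (_+ out y zs) (ω-whole w) ⟩
        suc (out y zs)             ≤⟨ out<second ⟩
        second y zs                ≤⟨ second-≤-∷ʳ y zs f ⟩
        second y (zs ∷ʳ f)         ≡⟨ second-↭ y perm ⟩
        second y representatives   ∎)
      where open ≤-Reasoning

    atLeastTwo : Fin n → AtLeastTwo SecondNeighbourhoodProperty
    atLeastTwo v = decidable-stable
      (any? λ p → any? λ q → ¬? (p ≟ q) ×-dec
        secondNeighbourhoodProperty? p ×-dec secondNeighbourhoodProperty? q)
      λ fewer → ¬¬-median-exists representatives λ { (L , perm , med) → fewer (fromMedian L perm med) }
      where
      fromMedian : ∀ L → L ↭ representatives → Median L → AtLeastTwo SecondNeighbourhoodProperty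
      fromMedian L perm med with initLast L
      ... | zs ∷ʳ′ f = median-two zs f perm med
      -- The order contains a representative of `v`, so it is not empty.
      ... | [] with find (Any-resp-↭ (↭-sym perm) (representative v))
      ...   | ()

theorem4p20 : (n : ℕ) .{{_ : NonZero n}} (D : OrientedGraph n) →
    Dependency.Good D →
    (∀ v → ¬ Neighbourhoods.Sink D v) →
    (∀ x → (∃[ e ] Dependency._∈ᵉ_ D x e) →
    AtLeastTwo (λ p → p ∈ Dependency.J D x ×
    Neighbourhoods.SecondNeighbourhoodProperty (D [ Dependency.J D x ]) p)) →
    AtLeastTwo (Neighbourhoods.SecondNeighbourhoodProperty D)
theorem4p20 (suc n) D good noSink inner = GoodDigraph.atLeastTwo D
  (Classes.together-interval D good) (Dependency.J D) (Classes.J-class D) noSink inner zero
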